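{- Suppose there exists a worst-case algorithm $A$ with time complexity $T(r)=\Omega(r)$ that solves subset sum. Then there is an algorithm $B$ with the same time complexity $T(r)$ that solves the worst-case search $k$-SUM problem (over the integers).
   Context: Subset sum (worst case): an instance is a vector $\mathbf{A}$ of $r$ integers and a target integer $t$; an algorithm solves the problem in time $T(r)$ if it finds a Boolean vector $\mathbf{x}\in\{0,1\}^r$ with $\mathbf{A}\cdot\mathbf{x}=t$ whenever such a vector exists. Search $k$-SUM over the integers (worst case): an instance is an array $X=(X_1,\dots,X_r)$ of $r$ integers; an algorithm solves the problem if it finds a set $S\subseteq[r]$ with $|S|=k$ and $\sum_{i\in S}X_i=0$ whenever such a set exists. Time complexities are expressed (up to constant factors) as functions of the number $r$ of integers. -}

module Defs where

open import Data.Bool.Base using (if_then_else_)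
open import Data.Fin.Base using (Fin; toℕ)
open import Data.Fin.Subset using (Subset; Side; inside; outside)
import Data.Fin.Subset as Subset
open import Data.Integer.Base as ℤ using (ℤ; +_; -[1+_]; 0ℤ; 1ℤ)
open import Data.List.Base using (List; _∷_; []; _++_; head; drop)
open import Data.List.Relation.Unary.All using (All)
open import Data.Maybe.Base using (Maybe; just; fromMaybe)
open import Data.Nat.Base using (ℕ; zero; suc; _+_; _*_; _^_; _≤_)
open import Data.Nat.Properties using (_≟_)
open import Data.Product.Base using (_×_; _,_; ∃; ∃-syntax)
open import Data.Vec.Base as Vec using (Vec; lookup; toList)
open import Relation.Binary.PropositionalEquality.Core using (_≡_)
open import Relation.Nullary using (¬_; does)

infix 4 _=O_ _=Ω_

_=O_ : (ℕ → ℕ) → (ℕ → ℕ) → Set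
f =O g = ∃[ c ] ∃[ r₀ ] (∀ r → r₀ ≤ r → f r ≤ c * g r)

_=Ω_ : (ℕ → ℕ) → (ℕ → ℕ) → Set
f =Ω g = g =O f

-- Algorithms are programs of a random access machine over the integers.
-- Every instruction takes one unit of time.  So that unit-cost arithmetic
-- is not a source of unbounded parallelism, the transition relation has a
-- parameter W, the largest absolute value a machine word can hold; an
-- instruction whose result exceeds W has no successor configuration.

Reg : Set
Reg = ℕ

data Op : Set where
  add sub mul div : Op

-- Integer division is that of Data.Integer (nonnegative remainder), with
-- quotient 0 for divisor 0.
⟦_⟧ : Op → ℤ → ℤ → ℤ
⟦ add ⟧ a b          = a ℤ.+ b
⟦ sub ⟧ a b          = a ℤ.- b
⟦ mul ⟧ a b          = a ℤ.* b
⟦ div ⟧ a (+ zero)   = 0ℤ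
⟦ div ⟧ a b@(+ suc _)   = a ℤ./ b
⟦ div ⟧ a b@(-[1+ _ ])  = a ℤ./ b

-- The first register is the destination, except that `store a s` writes
-- register s to the memory cell whose address is in register a.  Jump
-- targets are absolute positions in the program.
data Instr : Set where
  const : Reg → ℤ → Instr
  arith : Op → Reg → Reg → Reg → Instr
  load  : Reg → Reg → Instr
  store : Reg → Reg → Instr
  jzero : Reg → ℕ → Instr
  jpos  : Reg → ℕ → Instr
  halt  : Instr

Program : Set
Program = List Instr

record Config : Set where
  constructor ⟨_,_,_⟩
  field
    pc   : ℕ
    regs : Reg → ℤ
    mem  : ℕ → ℤ

open Config public

infixl 9 _[_≔_]

_[_≔_] : (ℕ → ℤ) → ℕ → ℤ → (ℕ → ℤ)
(f [ a ≔ v ]) b = if does (a ≟ b) then v else f b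

fetch : Program → ℕ → Maybe Instr
fetch P i = head (drop i P)

infix 3 _,_⊢_⟶_ _,_⊢_⟶[_]_

data _,_⊢_⟶_ (W : ℕ) (P : Program) : Config → Config → Set where

  step-const : ∀ {i ρ μ d z} → fetch P i ≡ just (const d z) →
    ℤ.∣ z ∣ ≤ W →
    W , P ⊢ ⟨ i , ρ , μ ⟩ ⟶ ⟨ suc i , ρ [ d ≔ z ] , μ ⟩

  step-arith : ∀ {i ρ μ o d a b} → fetch P i ≡ just (arith o d a b) →
    ℤ.∣ ⟦ o ⟧ (ρ a) (ρ b) ∣ ≤ W →
    W , P ⊢ ⟨ i , ρ , μ ⟩ ⟶ ⟨ suc i , ρ [ d ≔ ⟦ o ⟧ (ρ a) (ρ b) ] , μ ⟩

  step-load : ∀ {i ρ μ d a n} → fetch P i ≡ just (load d a) →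
    ρ a ≡ + n → ℤ.∣ μ n ∣ ≤ W →
    W , P ⊢ ⟨ i , ρ , μ ⟩ ⟶ ⟨ suc i , ρ [ d ≔ μ n ] , μ ⟩

  step-store : ∀ {i ρ μ a s n} → fetch P i ≡ just (store a s) →
    ρ a ≡ + n →
    W , P ⊢ ⟨ i , ρ , μ ⟩ ⟶ ⟨ suc i , ρ , μ [ n ≔ ρ s ] ⟩

  step-jzero-yes : ∀ {i ρ μ a j} → fetch P i ≡ just (jzero a j) →
    ρ a ≡ 0ℤ →
    W , P ⊢ ⟨ i , ρ , μ ⟩ ⟶ ⟨ j , ρ , μ ⟩

  step-jzero-no : ∀ {i ρ μ a j} → fetch P i ≡ just (jzero a j) →
    ¬ (ρ a ≡ 0ℤ) →
    W , P ⊢ ⟨ i , ρ , μ ⟩ ⟶ ⟨ suc i , ρ , μ ⟩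

  step-jpos-yes : ∀ {i ρ μ a j} → fetch P i ≡ just (jpos a j) →
    0ℤ ℤ.< ρ a →
    W , P ⊢ ⟨ i , ρ , μ ⟩ ⟶ ⟨ j , ρ , μ ⟩

  step-jpos-no : ∀ {i ρ μ a j} → fetch P i ≡ just (jpos a j) →
    ¬ (0ℤ ℤ.< ρ a) →
    W , P ⊢ ⟨ i , ρ , μ ⟩ ⟶ ⟨ suc i , ρ , μ ⟩

data _,_⊢_⟶[_]_ (W : ℕ) (P : Program) : Config → ℕ → Config → Set where
  done : ∀ {s} → W , P ⊢ s ⟶[ 0 ] s
  _then_ : ∀ {s s′ s″ n} → W , P ⊢ s ⟶ s′ → W , P ⊢ s′ ⟶[ n ] s″ →
    W , P ⊢ s ⟶[ suc n ] s″

-- Only the halt instruction counts as halting; overflow, a negative address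
-- or a program counter outside the program does not.
Halted : Program → Config → Set
Halted P s = fetch P (pc s) ≡ just halt

-- The input occupies the memory cells from address 0; everything else is 0.
initial : List ℤ → Config
initial zs = ⟨ 0 , (λ _ → 0ℤ) , (λ a → fromMaybe 0ℤ (head (drop a zs))) ⟩

-- Search problems whose solutions are Boolean vectors, equivalently subsets
-- of the index set {1, …, r}, where r is the length of the input array.
record SearchProblem : Set₁ where
  field
    Instance   : ℕ → Set
    input      : ∀ {r} → Instance r → List ℤ
    IsSolution : ∀ {r} → Instance r → Subset r → Set

bit : Side → ℤ
bit inside  = 1ℤ
bit outside = 0ℤ

-- The output x is left in the memory cells 1, …, r.
Outputs : ∀ {r} → Config → Subset r → Set
Outputs {r} s x = ∀ (i : Fin r) → mem s (suc (toℕ i)) ≡ bit (lookup x i)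

-- The program halts on every instance, and when a solution exists it outputs
-- one.  The machine words have O(log (U + time r)) bits, where U bounds the
-- integers in the input.
record _Solves_InTime_ (P : Program) (Π : SearchProblem) (T : ℕ → ℕ) : Set where
  open SearchProblem Π
  field
    time         : ℕ → ℕ
    time=O[T]    : time =O T
    wordExponent : ℕ
    run : ∀ {r} (I : Instance r) (U : ℕ) → All (λ z → ℤ.∣ z ∣ ≤ U) (input I) →
      ∃[ n ] ∃[ s ]
          n ≤ time r
        × ((2 + U + time r) ^ wordExponent , P ⊢ initial (input I) ⟶[ n ] s)
        × Halted P s
        × (∃ (IsSolution I) → ∃[ x ] (Outputs s x × IsSolution I x))

∑ : ∀ {r} → Vec ℤ r → ℤ
∑ = Vec.foldr′ ℤ._+_ 0ℤ

_·_ : ∀ {r} → Vec ℤ r → Vec ℤ r → ℤ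
A · B = ∑ (Vec.zipWith ℤ._*_ A B)

∑[_]_ : ∀ {r} → Subset r → Vec ℤ r → ℤ
∑[ S ] X = ∑ (Vec.zipWith (λ s z → if s then z else 0ℤ) S X)

SubsetSum : SearchProblem
SubsetSum = record
  { Instance   = λ r → Vec ℤ r × ℤ
  ; input      = λ { {r} (A , t) → + r ∷ toList A ++ t ∷ [] }
  ; IsSolution = λ (A , t) x → A · Vec.map bit x ≡ t
  }

_-SUM : ℕ → SearchProblem
k -SUM = record
  { Instance   = λ r → Vec ℤ r
  ; input      = λ {r} X → + r ∷ toList X
  ; IsSolution = λ X S → Subset.∣ S ∣ ≡ k × ∑[ S ] X ≡ 0ℤ
  }

{-# OPTIONS --safe #-}

-- With M = 1 + Σ Xᵢ², a subset S satisfies Σ_{i ∈ S} (Xᵢ + M) = k M if and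
-- only if (k − |S|) M = Σ_{i ∈ S} Xᵢ; the right-hand side is smaller than M in
-- absolute value, so this says |S| = k and Σ_{i ∈ S} Xᵢ = 0.  Hence k-SUM on X
-- is subset sum on the r integers Xᵢ + M with target k M.  The program B
-- computes this instance in place in O(r) steps, clears its registers and
-- continues with a relocated copy of A.

module Submission where

open import Data.Bool.Base using (true; false)
open import Data.Fin.Base using (toℕ)
open import Data.Fin.Subset using (Subset; inside; outside)
import Data.Fin.Subset as Subset
open import Data.Integer.Base as ℤ using (ℤ; +_; 0ℤ; 1ℤ)
import Data.Integer.Properties as ℤ
open import Data.Integer.Tactic.RingSolver using (solve-∀)
open import Data.List.Base using (List; []; _∷_; _++_; length; head; drop; map)
open import Data.List.Properties using (length-++)
open import Data.List.Relation.Unary.All as All using (All; []; _∷_)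
import Data.List.Relation.Unary.All.Properties as All
open import Data.Maybe.Base using (just; fromMaybe)
open import Data.Nat.Base
open import Data.Nat.Properties
import Data.Nat.Tactic.RingSolver as ℕ
open import Data.Product.Base using (_×_; _,_; ∃; ∃-syntax; proj₁; proj₂)
open import Data.Vec.Base as Vec using (Vec; []; _∷_; toList)
open import Data.Vec.Properties using (length-toList)
open import Defs
open import Function.Base using (id; _∘_)
open import Relation.Binary.Definitions using (tri<; tri≈; tri>)
open import Relation.Binary.PropositionalEquality
open import Relation.Nullary using (does)
open import Relation.Nullary.Decidable using (dec-true; dec-false)

private variable
  r : ℕ

-- Asymptotics

+-=O : ∀ {f g h} → f =O h → g =O h → (λ r → f r + g r) =O h
+-=O {f} {g} {h} (c , a , f≤) (d , b , g≤) = c + d , a + b , λ r a+b≤r → begin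
  f r + g r          ≤⟨ +-mono-≤ (f≤ r (≤-trans (m≤m+n a b) a+b≤r)) (g≤ r (≤-trans (m≤n+m b a) a+b≤r)) ⟩
  c * h r + d * h r  ≡⟨ *-distribʳ-+ (h r) c d ⟨
  (c + d) * h r      ∎
  where open ≤-Reasoning

affine=O : ∀ {h} a b → (λ r → r) =O h → (λ r → a + r * b) =O h
-- The threshold is `suc r₀` so that `r` is positive, which the bound `a ≤ a * r` needs.
affine=O {h} a b (c , r₀ , r≤) = (a + b) * c , suc r₀ , λ where
    r@(suc _) r₀<r → begin
      a + r * b          ≤⟨ +-monoˡ-≤ (r * b) (m≤m*n a r) ⟩
      a * r + r * b      ≡⟨ cong (_+_ (a * r)) (*-comm r b) ⟩
      a * r + b * r      ≡⟨ *-distribʳ-+ r a b ⟨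
      (a + b) * r        ≤⟨ *-monoʳ-≤ (a + b) (r≤ r (<⇒≤ r₀<r)) ⟩
      (a + b) * (c * h r) ≡⟨ *-assoc (a + b) c (h r) ⟨
      (a + b) * c * h r  ∎
  where open ≤-Reasoning

-- Lets a constant factor depending on `k` be absorbed into the exponent of a word bound.
n<m^n : ∀ m → 2 ≤ m → ∀ n → n < m ^ n
n<m^n m 2≤m zero    = ≤-refl
n<m^n m 2≤m (suc n) = begin
  2 + n                ≡⟨ +-suc 1 n ⟨
  1 + suc n            ≤⟨ +-mono-≤ (≤-trans (s≤s z≤n) ih) ih ⟩
  m ^ n + m ^ n        ≡⟨ cong (_+_ (m ^ n)) (+-identityʳ (m ^ n)) ⟨
  2 * m ^ n            ≤⟨ *-monoˡ-≤ (m ^ n) 2≤m ⟩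
  m * m ^ n            ∎
  where
  open ≤-Reasoning
  ih = n<m^n m 2≤m n

m≤m*m : ∀ m → m ≤ m * m
m≤m*m zero      = z≤n
m≤m*m m@(suc _) = m≤m*n m m

-- The reduction

i*i≡+∣i∣² : ∀ i → i ℤ.* i ≡ + (ℤ.∣ i ∣ * ℤ.∣ i ∣)
i*i≡+∣i∣² (+ n)        = sym (ℤ.pos-* n n)
i*i≡+∣i∣² ℤ.-[1+ n ] = refl

-- Squares replace absolute values: `∣ x ∣` is at most its square over the integers, and a machine
-- squares with one `mul` and no test of the sign.
‖_‖² : Vec ℤ r → ℕ
‖ [] ‖²    = 0
‖ x ∷ X ‖² = ℤ.∣ x ∣ * ℤ.∣ x ∣ + ‖ X ‖²

∣∑[]∣≤‖‖² : ∀ (S : Subset r) X → ℤ.∣ ∑[ S ] X ∣ ≤ ‖ X ‖²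
∣∑[]∣≤‖‖² []            []      = z≤n
∣∑[]∣≤‖‖² (inside  ∷ S) (x ∷ X) = ≤-trans (ℤ.∣i+j∣≤∣i∣+∣j∣ x (∑[ S ] X))
  (+-mono-≤ (m≤m*m ℤ.∣ x ∣) (∣∑[]∣≤‖‖² S X))
∣∑[]∣≤‖‖² (outside ∷ S) (x ∷ X) = ≤-trans (≤-reflexive (cong ℤ.∣_∣ (ℤ.+-identityˡ (∑[ S ] X))))
  (≤-trans (∣∑[]∣≤‖‖² S X) (m≤n+m ‖ X ‖² _))

‖‖²≤ : ∀ U (X : Vec ℤ r) → All (λ z → ℤ.∣ z ∣ ≤ U) (toList X) → ‖ X ‖² ≤ r * (U * U)
‖‖²≤ U []      []       = z≤n
‖‖²≤ U (x ∷ X) (p ∷ ps) = +-mono-≤ (*-mono-≤ p p) (‖‖²≤ U X ps)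

translated-· : ∀ c (X : Vec ℤ r) S →
  Vec.map (ℤ._+ c) X · Vec.map bit S ≡ + Subset.∣ S ∣ ℤ.* c ℤ.+ ∑[ S ] X
translated-· c []      []            = sym (trans (ℤ.+-identityʳ _) (ℤ.*-zeroˡ c))
translated-· c (x ∷ X) (inside ∷ S)  = trans
  (cong (ℤ._+_ ((x ℤ.+ c) ℤ.* 1ℤ)) (translated-· c X S))
  (lemma x c (+ Subset.∣ S ∣) (∑[ S ] X))
  where
  lemma : ∀ x c n s → (x ℤ.+ c) ℤ.* 1ℤ ℤ.+ (n ℤ.* c ℤ.+ s) ≡ (1ℤ ℤ.+ n) ℤ.* c ℤ.+ (x ℤ.+ s)
  lemma = solve-∀
translated-· c (x ∷ X) (outside ∷ S) = trans
  (cong (ℤ._+_ ((x ℤ.+ c) ℤ.* 0ℤ)) (translated-· c X S))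
  (lemma x c (+ Subset.∣ S ∣) (∑[ S ] X))
  where
  lemma : ∀ x c n s → (x ℤ.+ c) ℤ.* 0ℤ ℤ.+ (n ℤ.* c ℤ.+ s) ≡ n ℤ.* c ℤ.+ (0ℤ ℤ.+ s)
  lemma = solve-∀

-- The equation gives `s ≡ (n - m) * M`; a multiple of `M` smaller than `M` in absolute value has
-- factor zero.
digits-unique : ∀ m n M s → ℤ.∣ s ∣ < M →
  + m ℤ.* + M ℤ.+ s ≡ + n ℤ.* + M → m ≡ n × s ≡ 0ℤ
digits-unique m n M s ∣s∣<M eq =
  ℤ.+-injective (sym (ℤ.i-j≡0⇒i≡j (+ n) (+ m) (ℤ.∣i∣≡0⇒i≡0 ∣d∣≡0))) ,
  ℤ.∣i∣≡0⇒i≡0 (trans ∣s∣≡ (cong (_* M) ∣d∣≡0))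
  where
  open ≡-Reasoning
  d = + n ℤ.- + m

  cancel : ∀ a s → s ≡ a ℤ.+ s ℤ.- a
  cancel = solve-∀

  factor : ∀ a b c → b ℤ.* c ℤ.- a ℤ.* c ≡ (b ℤ.- a) ℤ.* c
  factor = solve-∀

  s≡ : s ≡ d ℤ.* + M
  s≡ = begin
    s                                            ≡⟨ cancel (+ m ℤ.* + M) s ⟩
    + m ℤ.* + M ℤ.+ s ℤ.- + m ℤ.* + M      ≡⟨ cong (ℤ._- + m ℤ.* + M) eq ⟩
    + n ℤ.* + M ℤ.- + m ℤ.* + M             ≡⟨ factor (+ m) (+ n) (+ M) ⟩
    d ℤ.* + M                                   ∎

  ∣s∣≡ : ℤ.∣ s ∣ ≡ ℤ.∣ d ∣ * M
  ∣s∣≡ = trans (cong ℤ.∣_∣ s≡) (ℤ.abs-* d (+ M))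

  ∣d∣≡0 : ℤ.∣ d ∣ ≡ 0
  ∣d∣≡0 = n<1⇒n≡0 (*-cancelʳ-< M ℤ.∣ d ∣ 1
    (subst₂ _<_ ∣s∣≡ (sym (*-identityˡ M)) ∣s∣<M))

-- The `suc` makes the bound on subset sums strict, even when every entry is zero.
modulus : Vec ℤ r → ℕ
modulus X = suc ‖ X ‖²

reduce : ℕ → Vec ℤ r → Vec ℤ r × ℤ
reduce k X = Vec.map (ℤ._+ + modulus X) X , + k ℤ.* + modulus X

module _ (k : ℕ) (X : Vec ℤ r) (S : Subset r) where
  private
    open SearchProblem
    M = modulus X

  reduce-complete : IsSolution (k -SUM) X S → IsSolution SubsetSum (reduce k X) S
  reduce-complete (∣S∣≡k , ∑≡0) = begin
    Vec.map (ℤ._+ + M) X · Vec.map bit S        ≡⟨ translated-· (+ M) X S ⟩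
    + Subset.∣ S ∣ ℤ.* + M ℤ.+ ∑[ S ] X        ≡⟨ cong₂ (λ a s → + a ℤ.* + M ℤ.+ s) ∣S∣≡k ∑≡0 ⟩
    + k ℤ.* + M ℤ.+ 0ℤ                         ≡⟨ ℤ.+-identityʳ _ ⟩
    + k ℤ.* + M                                 ∎
    where open ≡-Reasoning

  reduce-sound : IsSolution SubsetSum (reduce k X) S → IsSolution (k -SUM) X S
  reduce-sound eq = digits-unique Subset.∣ S ∣ k M (∑[ S ] X) (s≤s (∣∑[]∣≤‖‖² S X))
    (trans (sym (translated-· (+ M) X S)) eq)

-- Simulation up to pointwise equality

≔-same : ∀ f a v → (f [ a ≔ v ]) a ≡ v
≔-same f a v rewrite dec-true (a ≟ a) refl = refl

≔-other : ∀ f {a b} v → a ≢ b → (f [ a ≔ v ]) b ≡ f b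
≔-other f {a} {b} v a≢b rewrite dec-false (a ≟ b) a≢b = refl

≔-cong : ∀ {f g v w} a → f ≗ g → v ≡ w → f [ a ≔ v ] ≗ g [ a ≔ w ]
≔-cong a f≗g v≡w b with does (a ≟ b)
... | true  = v≡w
... | false = f≗g b

-- Jump targets are absolute, so moving a program to another offset rewrites its jumps and nothing
-- else.
relabel : (ℕ → ℕ) → Instr → Instr
relabel f (jzero a j) = jzero a (f j)
relabel f (jpos a j)  = jpos a (f j)
relabel f I           = I

relabel-id : ∀ I → relabel id I ≡ I
relabel-id (const _ _)     = refl
relabel-id (arith _ _ _ _) = refl
relabel-id (load _ _)      = refl
relabel-id (store _ _)     = refl
relabel-id (jzero _ _)     = refl
relabel-id (jpos _ _)      = refl
relabel-id halt            = refl

-- Registers and memory are functions, and successive updates agree with a closed description of the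
-- result only pointwise. Hence this relation instead of `≡` on configurations.
record Matches (f : ℕ → ℕ) (s t : Config) : Set where
  constructor matches
  field
    pc-≡   : pc t ≡ f (pc s)
    regs-≗ : regs t ≗ regs s
    mem-≗  : mem t ≗ mem s

open Matches

-- Serves twice: with `f = id` to join runs whose endpoints agree pointwise, and with a shift and a
-- larger word bound to run a relocated program.
module Simulation {W W′ P Q} (W≤W′ : W ≤ W′) (f : ℕ → ℕ)
  (f-suc : ∀ i → f (suc i) ≡ suc (f i))
  (fetch-f : ∀ i {I} → fetch P i ≡ just I → fetch Q (f i) ≡ just (relabel f I))
  where

  step : ∀ {s s′ t} → W , P ⊢ s ⟶ s′ → Matches f s t →
    ∃[ t′ ] (W′ , Q ⊢ t ⟶ t′) × Matches f s′ t′
  step (step-const {d = d} e z≤W) (matches refl ρ μ) =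
    _ , step-const (fetch-f _ e) (≤-trans z≤W W≤W′) ,
    matches (sym (f-suc _)) (≔-cong d ρ refl) μ
  step (step-arith {o = o} {d} {a} {b} e v≤W) (matches refl ρ μ) =
    _ , step-arith (fetch-f _ e) (≤-trans (≤-reflexive (cong ℤ.∣_∣ v≡)) (≤-trans v≤W W≤W′)) ,
    matches (sym (f-suc _)) (≔-cong d ρ v≡) μ
    where v≡ = cong₂ ⟦ o ⟧ (ρ a) (ρ b)
  step (step-load {d = d} {a} {n} e ρa≡n v≤W) (matches refl ρ μ) =
    _ , step-load (fetch-f _ e) (trans (ρ a) ρa≡n)
      (≤-trans (≤-reflexive (cong ℤ.∣_∣ (μ n))) (≤-trans v≤W W≤W′)) ,
    matches (sym (f-suc _)) (≔-cong d ρ (μ n)) μ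
  step (step-store {a = a} {s} {n} e ρa≡n) (matches refl ρ μ) =
    _ , step-store (fetch-f _ e) (trans (ρ a) ρa≡n) ,
    matches (sym (f-suc _)) ρ (≔-cong n μ (ρ s))
  step (step-jzero-yes {a = a} e ρa≡0) (matches refl ρ μ) =
    _ , step-jzero-yes (fetch-f _ e) (trans (ρ a) ρa≡0) , matches refl ρ μ
  step (step-jzero-no {a = a} e ρa≢0) (matches refl ρ μ) =
    _ , step-jzero-no (fetch-f _ e) (ρa≢0 ∘ trans (sym (ρ a))) , matches (sym (f-suc _)) ρ μ
  step (step-jpos-yes {a = a} e ρa>0) (matches refl ρ μ) =
    _ , step-jpos-yes (fetch-f _ e) (subst (0ℤ ℤ.<_) (sym (ρ a)) ρa>0) , matches refl ρ μ
  step (step-jpos-no {a = a} e ρa≯0) (matches refl ρ μ) =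
    _ , step-jpos-no (fetch-f _ e) (ρa≯0 ∘ subst (0ℤ ℤ.<_) (ρ a)) , matches (sym (f-suc _)) ρ μ

  steps : ∀ {s s′ t n} → W , P ⊢ s ⟶[ n ] s′ → Matches f s t →
    ∃[ t′ ] (W′ , Q ⊢ t ⟶[ n ] t′) × Matches f s′ t′
  steps done         m = _ , done , m
  steps (x then xs) m with step x m
  ... | _ , y , m′ with steps xs m′
  ... | _ , ys , m″ = _ , y then ys , m″

-- Concatenation of runs and of programs.

infix 3 _,_⊢_⇒[_]_
infixr 5 _▷_ _⨾_ _⨾≈_

pattern _▷_ x xs = x then xs

_⨾_ : ∀ {W P s t u m n} → W , P ⊢ s ⟶[ m ] t → W , P ⊢ t ⟶[ n ] u → W , P ⊢ s ⟶[ m + n ] u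
done        ⨾ ys = ys
(x then xs) ⨾ ys = x then (xs ⨾ ys)

_,_⊢_⇒[_]_ : ℕ → Program → Config → ℕ → Config → Set
W , P ⊢ s ⇒[ n ] t = ∃[ t′ ] (W , P ⊢ s ⟶[ n ] t′) × Matches id t t′

-- The first run ends only pointwise at `t`, so the second is replayed from the actual endpoint by
-- the simulation along `id`.
_⨾≈_ : ∀ {W P s t u m n} → W , P ⊢ s ⇒[ m ] t → W , P ⊢ t ⇒[ n ] u → W , P ⊢ s ⇒[ m + n ] u
_⨾≈_ {P = P} (_ , xs , m) (_ , ys , matches p ρ μ)
  with Simulation.steps ≤-refl id (λ _ → refl)
         (λ i {I} e → trans e (cong just (sym (relabel-id I)))) ys m
... | _ , zs , matches p′ ρ′ μ′ =
  _ , xs ⨾ zs ,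
  matches (trans p′ p) (λ a → trans (ρ′ a) (ρ a)) (λ a → trans (μ′ a) (μ a))

fetch-++ : ∀ P Q i → fetch (P ++ Q) (i + length P) ≡ fetch Q i
fetch-++ []      Q i rewrite +-identityʳ i         = refl
fetch-++ (I ∷ P) Q i rewrite +-suc i (length P) = fetch-++ P Q i

fetch-relabel : ∀ f P i {I} → fetch P i ≡ just I → fetch (map (relabel f) P) i ≡ just (relabel f I)
fetch-relabel f (I ∷ P) zero    refl = refl
fetch-relabel f (I ∷ P) (suc i) e    = fetch-relabel f P i e

-- Array cells

-- Definitionally the memory of `initial zs`.
cell : List ℤ → ℕ → ℤ
cell zs a = fromMaybe 0ℤ (head (drop a zs))

cell-bound : ∀ {U} zs → All (λ z → ℤ.∣ z ∣ ≤ U) zs → ∀ a → ℤ.∣ cell zs a ∣ ≤ U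
cell-bound []       []       zero    = z≤n
cell-bound []       []       (suc a) = z≤n
cell-bound (z ∷ zs) (p ∷ ps) zero    = p
cell-bound (z ∷ zs) (p ∷ ps) (suc a) = cell-bound zs ps a

cell-beyond : ∀ zs {a} → length zs ≤ a → cell zs a ≡ 0ℤ
cell-beyond []       {zero}  _       = refl
cell-beyond []       {suc a} _       = refl
cell-beyond (z ∷ zs) (s≤s l) = cell-beyond zs l

cell-map : ∀ f (X : Vec ℤ r) zs {a} → a < r →
  cell (toList (Vec.map f X) ++ zs) a ≡ f (cell (toList X) a)
cell-map f (x ∷ X) zs {zero}  _         = refl
cell-map f (x ∷ X) zs {suc a} (s≤s a<r) = cell-map f X zs a<r

cell-++ : ∀ (X : Vec ℤ r) z zs → cell (toList X ++ z ∷ zs) r ≡ z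
cell-++ []      z zs = refl
cell-++ (x ∷ X) z zs = cell-++ X z zs

-- The recursion takes the last term off, as the program does.
energy : (ℕ → ℤ) → ℕ → ℕ
energy ν zero    = 0
energy ν (suc i) = ℤ.∣ ν i ∣ * ℤ.∣ ν i ∣ + energy ν i

-- Reconciles two orders of summation: `energy` peels off the last entry, `‖_‖²` the first.
energy-suc : ∀ ν i → energy ν (suc i) ≡ ℤ.∣ ν 0 ∣ * ℤ.∣ ν 0 ∣ + energy (ν ∘ suc) i
energy-suc ν zero    = refl
energy-suc ν (suc i) = begin
  b + energy ν (suc i)              ≡⟨ cong (_+_ b) (energy-suc ν i) ⟩
  b + (a + energy (ν ∘ suc) i)      ≡⟨ +-assoc b a _ ⟨
  b + a + energy (ν ∘ suc) i        ≡⟨ cong (_+ energy (ν ∘ suc) i) (+-comm b a) ⟩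
  a + b + energy (ν ∘ suc) i        ≡⟨ +-assoc a b _ ⟩
  a + (b + energy (ν ∘ suc) i)      ∎
  where
  open ≡-Reasoning
  a = ℤ.∣ ν 0 ∣ * ℤ.∣ ν 0 ∣
  b = ℤ.∣ ν (suc i) ∣ * ℤ.∣ ν (suc i) ∣

energy-cell : (X : Vec ℤ r) → energy (cell (toList X)) r ≡ ‖ X ‖²
energy-cell []              = refl
energy-cell {suc r} (x ∷ X) = trans (energy-suc (cell (x ∷ toList X)) r)
  (cong (_+_ (ℤ.∣ x ∣ * ℤ.∣ x ∣)) (energy-cell X))

-- The memory left by the second loop, which writes cells `i` down to 1. Cell 0, which holds the
-- array length, is spared.
translate : ℤ → ℕ → (ℕ → ℤ) → (ℕ → ℤ)
translate c zero    μ = μ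
translate c (suc i) μ = translate c i (μ [ suc i ≔ μ (suc i) ℤ.+ c ])

translate-zero : ∀ c i μ → translate c i μ 0 ≡ μ 0
translate-zero c zero    μ = refl
translate-zero c (suc i) μ = translate-zero c i _

translate-above : ∀ c i μ {j} → i < j → translate c i μ j ≡ μ j
translate-above c zero    μ i<j = refl
translate-above c (suc i) μ i<j =
  trans (translate-above c i _ (<⇒≤ i<j)) (≔-other μ _ (<⇒≢ i<j))

-- Cell `suc j` is written exactly once: earlier writes hit higher cells, later ones lower cells.
translate-below : ∀ c i μ {j} → j < i → translate c i μ (suc j) ≡ μ (suc j) ℤ.+ c
translate-below c (suc i) μ {j} j<1+i with <-cmp j i
... | tri< j<i _ _  = trans (translate-below c i _ j<i)
  (cong (ℤ._+ c) (≔-other μ _ (<⇒≢ (s≤s j<i) ∘ sym)))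
... | tri≈ _ refl _ = trans (translate-above c i _ ≤-refl) (≔-same μ (suc i) _)
... | tri> _ _ j>i  with () ← <⇒≱ j<1+i j>i

-- Past cell 0 there are three regions: array cells, each shifted once; cell `suc r`, out of reach
-- of the loop and holding the target; and cells beyond both lists, zero by default.
translate-cell : ∀ c t z (X : Vec ℤ r) →
  translate c r (cell (z ∷ toList X) [ suc r ≔ t ]) ≗ cell (z ∷ toList (Vec.map (ℤ._+ c) X) ++ t ∷ [])
translate-cell {r} c t z X zero = translate-zero c r _
translate-cell {r} c t z X (suc j) with <-cmp j r
... | tri< j<r _ _ = begin
  translate c r (μ [ suc r ≔ t ]) (suc j)           ≡⟨ translate-below c r _ j<r ⟩
  (μ [ suc r ≔ t ]) (suc j) ℤ.+ c                   ≡⟨ cong (ℤ._+ c) (≔-other μ t (<⇒≢ (s≤s j<r) ∘ sym)) ⟩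
  cell (toList X) j ℤ.+ c                           ≡⟨ cell-map (ℤ._+ c) X (t ∷ []) j<r ⟨
  cell (toList (Vec.map (ℤ._+ c) X) ++ t ∷ []) j    ∎
  where
  open ≡-Reasoning
  μ = cell (z ∷ toList X)
... | tri≈ _ refl _ = trans (translate-above c r _ ≤-refl)
  (trans (≔-same (cell (z ∷ toList X)) (suc r) t) (sym (cell-++ (Vec.map (ℤ._+ c) X) t [])))
... | tri> _ _ j>r = begin
  translate c r (μ [ suc r ≔ t ]) (suc j)           ≡⟨ translate-above c r _ (s≤s (<⇒≤ j>r)) ⟩
  (μ [ suc r ≔ t ]) (suc j)                         ≡⟨ ≔-other μ t (<⇒≢ (s≤s j>r)) ⟩
  cell (toList X) j                                 ≡⟨ cell-beyond (toList X) (≤-trans (≤-reflexive (length-toList X)) (<⇒≤ j>r)) ⟩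
  0ℤ                                                ≡⟨ cell-beyond (toList Y ++ t ∷ []) (≤-trans (≤-reflexive length≡) j>r) ⟨
  cell (toList Y ++ t ∷ []) j                       ∎
  where
  open ≡-Reasoning
  μ = cell (z ∷ toList X)
  Y = Vec.map (ℤ._+ c) X
  length≡ : length (toList Y ++ t ∷ []) ≡ suc r
  length≡ = trans (length-++ (toList Y)) (trans (cong (_+ 1) (length-toList Y)) (+-comm r 1))

-- The preprocessing program

-- Register 0 accumulates M, register 1 is the loop index, register 3 holds 1;
-- register 4 is never written, so `jzero 4` is an unconditional jump.
preamble : ℕ → Program
preamble k =
  const 3 1ℤ ∷
  const 0 1ℤ ∷
  load 1 4 ∷
  jzero 1 9 ∷
  load 2 1 ∷
  arith mul 2 2 2 ∷
  arith add 0 0 2 ∷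
  arith sub 1 1 3 ∷
  jzero 4 3 ∷
  load 1 4 ∷
  arith add 1 3 1 ∷
  const 2 (+ k) ∷
  arith mul 2 2 0 ∷
  store 1 2 ∷
  arith sub 1 1 3 ∷
  jzero 1 21 ∷
  load 2 1 ∷
  arith add 2 2 0 ∷
  store 1 2 ∷
  arith sub 1 1 3 ∷
  jzero 4 15 ∷
  const 0 0ℤ ∷
  const 2 0ℤ ∷
  const 3 0ℤ ∷
  []

file : ℤ → ℤ → ℤ → ℤ → Reg → ℤ
file a b c d 0 = a
file a b c d 1 = b
file a b c d 2 = c
file a b c d 3 = d
file a b c d _ = 0ℤ

-- Grouped like the right-nested chain of five runs in `reduces`, so that step counts agree by
-- computation. A loop costs 6 steps per round and 1 for the exit test.
preambleTime : ℕ → ℕ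
preambleTime r = 3 + ((r * 6 + 1) + (6 + ((r * 6 + 1) + 3)))

module Preamble (W k : ℕ) (Q : Program) where

  P : Program
  P = preamble k ++ Q

  -- Positions 3 to 8. The invariant is that the accumulator plus the squares still unread equals
  -- the fixed `total`; all terms being nonnegative, `total ≤ W` bounds every intermediate sum.
  -- Register 2 is scratch, hence the existential `s′`.
  sumSquares : ∀ i m {total} s μ → (∀ j → ℤ.∣ μ j ∣ ≤ W) → i ≤ W →
    m + energy (μ ∘ suc) i ≡ total → total ≤ W →
    ∃[ s′ ] (W , P ⊢ ⟨ 3 , file (+ m) (+ i) s 1ℤ , μ ⟩ ⇒[ i * 6 + 1 ]
                     ⟨ 9 , file (+ total) 0ℤ s′ 1ℤ , μ ⟩)
  sumSquares zero m s μ μ≤W i≤W total≡ total≤W =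
    s , _ , step-jzero-yes refl refl ▷ done ,
    matches refl (λ { 0 → cong +_ (trans (sym (+-identityʳ m)) total≡) ; 1 → refl ; 2 → refl ; 3 → refl
                    ; (suc (suc (suc (suc _)))) → refl }) (λ _ → refl)
  sumSquares (suc i) m {total} s μ μ≤W i<W total≡ total≤W =
    proj₁ rest , body ⨾≈ proj₂ rest
    where
    x = μ (suc i)
    q = ℤ.∣ x ∣ * ℤ.∣ x ∣

    m+q≤W : m + q ≤ W
    m+q≤W = ≤-trans (+-monoʳ-≤ m (m≤m+n q _)) (≤-trans (≤-reflexive total≡) total≤W)

    body : W , P ⊢ ⟨ 3 , file (+ m) (+ suc i) s 1ℤ , μ ⟩ ⇒[ 6 ] ⟨ 3 , file (+ (m + q)) (+ i) (+ q) 1ℤ , μ ⟩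
    body =
      _ ,
      step-jzero-no refl (λ ()) ▷
      step-load refl refl (μ≤W (suc i)) ▷
      step-arith refl (≤-trans (≤-reflexive (ℤ.abs-* x x)) (≤-trans (m≤n+m q m) m+q≤W)) ▷
      step-arith refl (≤-trans (≤-reflexive (cong (λ y → ℤ.∣ + m ℤ.+ y ∣) (i*i≡+∣i∣² x))) m+q≤W) ▷
      step-arith refl (<⇒≤ i<W) ▷
      step-jzero-yes refl refl ▷
      done ,
      matches refl
        (λ { 0 → cong (ℤ._+_ (+ m)) (i*i≡+∣i∣² x) ; 1 → refl ; 2 → i*i≡+∣i∣² x ; 3 → refl
           ; (suc (suc (suc (suc _)))) → refl })
        (λ _ → refl)

    rest = sumSquares i (m + q) (+ q) μ μ≤W (<⇒≤ i<W) (trans (+-assoc m q _) total≡) total≤W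

  -- Positions 15 to 20. The bound `U` is asked only of cells up to `i`, since those above hold
  -- shifted entries and the target, which may exceed it.
  addModulus : ∀ i U M s μ → (∀ j → j ≤ i → ℤ.∣ μ j ∣ ≤ U) → i ≤ W → U + M ≤ W →
    ∃[ s′ ] (W , P ⊢ ⟨ 15 , file (+ M) (+ i) s 1ℤ , μ ⟩ ⇒[ i * 6 + 1 ]
                     ⟨ 21 , file (+ M) 0ℤ s′ 1ℤ , translate (+ M) i μ ⟩)
  addModulus zero U M s μ μ≤U i≤W U+M≤W =
    s , _ , step-jzero-yes refl refl ▷ done , matches refl (λ _ → refl) (λ _ → refl)
  addModulus (suc i) U M s μ μ≤U i<W U+M≤W = proj₁ rest , body ⨾≈ proj₂ rest
    where
    x = μ (suc i)

    body : W , P ⊢ ⟨ 15 , file (+ M) (+ suc i) s 1ℤ , μ ⟩ ⇒[ 6 ]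
                   ⟨ 15 , file (+ M) (+ i) (x ℤ.+ + M) 1ℤ , μ [ suc i ≔ x ℤ.+ + M ] ⟩
    body =
      _ ,
      step-jzero-no refl (λ ()) ▷
      step-load refl refl (≤-trans (μ≤U (suc i) ≤-refl) (≤-trans (m≤m+n U M) U+M≤W)) ▷
      step-arith refl (≤-trans (ℤ.∣i+j∣≤∣i∣+∣j∣ x (+ M)) (≤-trans (+-monoˡ-≤ M (μ≤U (suc i) ≤-refl)) U+M≤W)) ▷
      step-store refl refl ▷
      step-arith refl (<⇒≤ i<W) ▷
      step-jzero-yes refl refl ▷
      done ,
      matches refl
        (λ { 0 → refl ; 1 → refl ; 2 → refl ; 3 → refl ; (suc (suc (suc (suc _)))) → refl })
        (λ _ → refl)

    rest = addModulus i U M (x ℤ.+ + M) (μ [ suc i ≔ x ℤ.+ + M ])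
      (λ j j≤i → ≤-trans (≤-reflexive (cong ℤ.∣_∣ (≔-other μ _ (<⇒≢ (s≤s j≤i) ∘ sym)))) (μ≤U j (m≤n⇒m≤1+n j≤i)))
      (<⇒≤ i<W) U+M≤W

  open SearchProblem using (input)

  -- The endpoint differs from the initial configuration for the reduced instance only in its
  -- program counter. The word bounds cover, in order, addresses, shifted entries, the constant `k`
  -- and the target.
  reduces : ∀ (X : Vec ℤ r) U → All (λ z → ℤ.∣ z ∣ ≤ U) (input (k -SUM) X) →
    suc r ≤ W → U + modulus X ≤ W → k ≤ W → k * modulus X ≤ W →
    W , P ⊢ initial (input (k -SUM) X) ⇒[ preambleTime r ]
            ⟨ 24 , (λ _ → 0ℤ) , mem (initial (input SubsetSum (reduce k X))) ⟩
  reduces {r} X U X≤U r<W U+M≤W k≤W kM≤W =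
    start ⨾≈ proj₂ loop₁ ⨾≈ middle ⨾≈ proj₂ loop₂ ⨾≈ end
    where
    M = modulus X
    t = + k ℤ.* + M
    μ₀ = cell (input (k -SUM) X)
    μ₀≤U = cell-bound (input (k -SUM) X) X≤U
    1≤W = ≤-trans (s≤s z≤n) r<W
    U≤W = ≤-trans (m≤m+n U M) U+M≤W
    M≤W = ≤-trans (m≤n+m M U) U+M≤W

    start : W , P ⊢ initial (input (k -SUM) X) ⇒[ 3 ] ⟨ 3 , file (+ 1) (+ r) 0ℤ 1ℤ , μ₀ ⟩
    start =
      _ ,
      step-const refl 1≤W ▷
      step-const refl 1≤W ▷
      step-load refl refl (<⇒≤ r<W) ▷
      done ,
      matches refl
        (λ { 0 → refl ; 1 → refl ; 2 → refl ; 3 → refl ; (suc (suc (suc (suc _)))) → refl })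
        (λ _ → refl)

    -- The accumulator starts at 1, which supplies the `suc` of `modulus`.
    loop₁ = sumSquares r 1 0ℤ μ₀ (λ j → ≤-trans (μ₀≤U j) U≤W) (<⇒≤ r<W) (cong suc (energy-cell X)) M≤W

    middle : W , P ⊢ ⟨ 9 , file (+ M) 0ℤ (proj₁ loop₁) 1ℤ , μ₀ ⟩ ⇒[ 6 ] ⟨ 15 , file (+ M) (+ r) t 1ℤ , μ₀ [ suc r ≔ t ] ⟩
    middle =
      _ ,
      -- The first loop consumed the index, so `r` is reloaded from cell 0 (register 4 is the zero
      -- address). Adding 1 gives the cell just past the array, where the target goes.
      step-load refl refl (<⇒≤ r<W) ▷
      step-arith refl r<W ▷
      step-const refl k≤W ▷
      step-arith refl (≤-trans (≤-reflexive (ℤ.abs-* (+ k) (+ M))) kM≤W) ▷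
      step-store refl refl ▷
      step-arith refl (<⇒≤ r<W) ▷
      done ,
      matches refl
        (λ { 0 → refl ; 1 → refl ; 2 → refl ; 3 → refl ; (suc (suc (suc (suc _)))) → refl })
        (λ _ → refl)

    loop₂ = addModulus r U M t (μ₀ [ suc r ≔ t ])
      (λ j j≤r → ≤-trans (≤-reflexive (cong ℤ.∣_∣ (≔-other μ₀ t (<⇒≢ (s≤s j≤r) ∘ sym)))) (μ₀≤U j))
      (<⇒≤ r<W) U+M≤W

    end : W , P ⊢ ⟨ 21 , file (+ M) 0ℤ (proj₁ loop₂) 1ℤ , translate (+ M) r (μ₀ [ suc r ≔ t ]) ⟩ ⇒[ 3 ]
                  ⟨ 24 , (λ _ → 0ℤ) , mem (initial (input SubsetSum (reduce k X))) ⟩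
    end =
      _ ,
      -- The loop left register 1 at zero, so three resets clear the whole file.
      step-const refl z≤n ▷
      step-const refl z≤n ▷
      step-const refl z≤n ▷
      done ,
      matches refl
        (λ { 0 → refl ; 1 → refl ; 2 → refl ; 3 → refl ; (suc (suc (suc (suc _)))) → refl })
        (translate-cell (+ M) t (+ r) X)

-- Magnitudes

-- The length `r` is itself an input entry, so `r ≤ U` and the modulus is at most `suc U ^ 3`. Of
-- the `2 + k` copies of this cube, one covers `U`, one the modulus, and `k` the target.
sizeBound : ℕ → ℕ → ℕ
sizeBound k U = (2 + k) * suc U ^ 3

module _ (k U : ℕ) (X : Vec ℤ r) (X≤U : All (λ z → ℤ.∣ z ∣ ≤ U) (+ r ∷ toList X)) where
  private
    C = suc U ^ 3

    r≤U : r ≤ U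
    r≤U = All.head X≤U

    1+U≤C : suc U ≤ C
    1+U≤C = m≤m*n (suc U) (suc U ^ 2) ⦃ m^n≢0 (suc U) 2 ⦄

    M≤C : modulus X ≤ C
    -- `modulus X ≤ C` unfolds to `‖ X ‖² < C`, hence a strict chain.
    M≤C = begin-strict
      ‖ X ‖²                         ≤⟨ ‖‖²≤ U X (All.tail X≤U) ⟩
      r * (U * U)                    ≤⟨ *-monoˡ-≤ (U * U) r≤U ⟩
      U * (U * U)                    <⟨ *-mono-< (n<1+n U) (*-mono-< (n<1+n U) (n<1+n U)) ⟩
      suc U * (suc U * suc U)        ≡⟨ cong (λ a → suc U * (suc U * a)) (*-identityʳ (suc U)) ⟨
      suc U * (suc U * (suc U * 1))  ∎
      where open ≤-Reasoning

    C≤V : C ≤ sizeBound k U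
    C≤V = m≤m+n C _

    kC≤V : k * C ≤ sizeBound k U
    kC≤V = ≤-trans (m≤n+m (k * C) C) (m≤n+m (C + k * C) C)

  suc-r≤V : suc r ≤ sizeBound k U
  suc-r≤V = ≤-trans (s≤s r≤U) (≤-trans 1+U≤C C≤V)

  U+modulus≤V : U + modulus X ≤ sizeBound k U
  U+modulus≤V = +-mono-≤ (<⇒≤ 1+U≤C) (≤-trans M≤C (m≤m+n C (k * C)))

  k≤V : k ≤ sizeBound k U
  k≤V = ≤-trans (m≤m*n k C ⦃ m^n≢0 (suc U) 3 ⦄) kC≤V

  k*modulus≤V : k * modulus X ≤ sizeBound k U
  k*modulus≤V = ≤-trans (*-monoʳ-≤ k M≤C) kC≤V

  reduce-bounded : All (λ z → ℤ.∣ z ∣ ≤ sizeBound k U) (SearchProblem.input SubsetSum (reduce k X))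
  reduce-bounded = <⇒≤ suc-r≤V ∷ All.++⁺ (translated X (All.tail X≤U))
    (≤-trans (≤-reflexive (ℤ.abs-* (+ k) (+ modulus X))) k*modulus≤V ∷ [])
    where
    translated : ∀ {n} (Y : Vec ℤ n) → All (λ z → ℤ.∣ z ∣ ≤ U) (toList Y) →
      All (λ z → ℤ.∣ z ∣ ≤ sizeBound k U) (toList (Vec.map (ℤ._+ + modulus X) Y))
    translated []      []       = []
    translated (y ∷ Y) (p ∷ ps) =
      ≤-trans (ℤ.∣i+j∣≤∣i∣+∣j∣ y _) (≤-trans (+-monoˡ-≤ _ p) U+modulus≤V) ∷ translated Y ps

-- Compares the bases of the two word bounds, with `a` the preamble time and `b` the time of the
-- subset-sum program. Both `2 + b` and `suc U ^ 3` are at most `N ^ 3`, giving `(3 + k) * N ^ 3`,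
-- and `3 + k` is below `N ^ (3 + k)`.
sizeBound-poly : ∀ k U a b → 2 + sizeBound k U + b ≤ (2 + U + (a + b)) ^ (6 + k)
sizeBound-poly k U a b = begin
  2 + sizeBound k U + b        ≡⟨ swap (sizeBound k U) b ⟩
  (2 + b) + sizeBound k U      ≤⟨ +-mono-≤ 2+b≤N³ (*-monoʳ-≤ (2 + k) (^-monoˡ-≤ 3 1+U≤N)) ⟩
  (3 + k) * N ^ 3              ≤⟨ *-monoˡ-≤ (N ^ 3) (<⇒≤ (n<m^n N (s≤s (s≤s z≤n)) (3 + k))) ⟩
  N ^ (3 + k) * N ^ 3          ≡⟨ ^-distribˡ-+-* N (3 + k) 3 ⟨
  N ^ (3 + k + 3)              ≡⟨ cong (N ^_) (cong (_+_ 3) (+-comm k 3)) ⟩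
  N ^ (6 + k)                  ∎
  where
  open ≤-Reasoning
  N = 2 + U + (a + b)

  swap : ∀ v b → 2 + v + b ≡ (2 + b) + v
  swap = ℕ.solve-∀

  1+U≤N : suc U ≤ N
  1+U≤N = ≤-trans (n≤1+n (suc U)) (m≤m+n (2 + U) (a + b))

  2+b≤N³ : 2 + b ≤ N ^ 3
  2+b≤N³ = ≤-trans (s≤s (s≤s (≤-trans (m≤n+m b a) (m≤n+m (a + b) U)))) (m≤m*n N (N ^ 2) ⦃ m^n≢0 N 2 ⦄)

-- The composite program: correctness, time and word size.

module Composite (k : ℕ) (T : ℕ → ℕ) (T=Ω : T =Ω (λ r → r))
  (A : Program) (solves : A Solves SubsetSum InTime T) where

  open SearchProblem
  private module A = _Solves_InTime_ solves

  -- 24 is the length of `preamble k`, so `shift 0` is the counter at which the preamble ends.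
  shift : ℕ → ℕ
  shift i = i + 24

  B : Program
  B = preamble k ++ map (relabel shift) A

  fetch-shift : ∀ i {I} → fetch A i ≡ just I → fetch B (shift i) ≡ just (relabel shift I)
  fetch-shift i e = trans (fetch-++ (preamble k) (map (relabel shift) A) i) (fetch-relabel shift A i e)

  time : ℕ → ℕ
  time r = preambleTime r + A.time r

  -- The linear cost of the preamble is absorbed by `T` through `T=Ω`.
  time=O : time =O T
  time=O = +-=O preambleTime=O A.time=O[T]
    where
    affine : ∀ r → 3 + ((r * 6 + 1) + (6 + ((r * 6 + 1) + 3))) ≡ 14 + r * 12
    affine = ℕ.solve-∀

    preambleTime=O : preambleTime =O T
    preambleTime=O with affine=O 14 12 T=Ω
    ... | c , r₀ , h = c , r₀ , λ r r₀≤r → ≤-trans (≤-reflexive (affine r)) (h r r₀≤r)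

  -- The factor `6 + k` pays for the change of base. The `suc` keeps the exponent at least `6 + k`,
  -- as the preamble requires even if `A.wordExponent` is zero.
  wordExponent : ℕ
  wordExponent = (6 + k) * suc A.wordExponent

  runFrom : ∀ {W U} (X : Vec ℤ r) → All (λ z → ℤ.∣ z ∣ ≤ U) (input (k -SUM) X) →
    sizeBound k U ≤ W → (2 + sizeBound k U + A.time r) ^ A.wordExponent ≤ W →
    ∃[ n ] ∃[ s ]
        n ≤ time r
      × (W , B ⊢ initial (input (k -SUM) X) ⟶[ n ] s)
      × Halted B s
      × (∃ (IsSolution (k -SUM) X) → ∃[ S ] (Outputs s S × IsSolution (k -SUM) X S))
  runFrom {r} {W} {U} X X≤U V≤W W-A≤W =
    let _ , first , matches pc≡ ρ μ =
          Preamble.reduces W k (map (relabel shift) A) X U X≤U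
            (≤-trans (suc-r≤V k U X X≤U) V≤W) (≤-trans (U+modulus≤V k U X X≤U) V≤W)
            (≤-trans (k≤V k U X X≤U) V≤W) (≤-trans (k*modulus≤V k U X X≤U) V≤W)
        n , s , n≤ , second , halted , found = A.run (reduce k X) (sizeBound k U) (reduce-bounded k U X X≤U)
        -- The actual endpoint of the preamble matches the initial configuration of `A` along
        -- `shift`, so the run of `A` is replayed there with its word bound raised to `W`.
        t , second′ , m =
          Simulation.steps W-A≤W shift (λ _ → refl) fetch-shift second (matches pc≡ ρ μ)
    in preambleTime r + n , t , +-monoʳ-≤ (preambleTime r) n≤ , first ⨾ second′ ,
       trans (cong (fetch B) (pc-≡ m)) (fetch-shift (pc s) halted) ,
       -- Completeness of the reduction triggers the guarantee of `A`; soundness turns its answer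
       -- into a `k`-SUM solution, the subset being the same, so the output cells need no
       -- conversion.
       λ (S₀ , sol) →
         let S , out , S-sol = found (S₀ , reduce-complete k X S₀ sol)
         in S , (λ i → trans (mem-≗ m (suc (toℕ i))) (out i)) , reduce-sound k X S S-sol

  module _ (r U : ℕ) where
    private
      N = 2 + U + time r
      V = sizeBound k U

    V≤W : V ≤ N ^ wordExponent
    V≤W = begin
      V                  ≤⟨ m≤n+m V 2 ⟩
      2 + V              ≤⟨ m≤m+n (2 + V) (A.time r) ⟩
      2 + V + A.time r   ≤⟨ sizeBound-poly k U (preambleTime r) (A.time r) ⟩
      N ^ (6 + k)        ≤⟨ ^-monoʳ-≤ N (m≤m*n (6 + k) (suc A.wordExponent)) ⟩
      N ^ wordExponent   ∎
      where open ≤-Reasoning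

    W-A≤W : (2 + V + A.time r) ^ A.wordExponent ≤ N ^ wordExponent
    W-A≤W = begin
      (2 + V + A.time r) ^ A.wordExponent  ≤⟨ ^-monoˡ-≤ A.wordExponent (sizeBound-poly k U (preambleTime r) (A.time r)) ⟩
      (N ^ (6 + k)) ^ A.wordExponent       ≡⟨ ^-*-assoc N (6 + k) A.wordExponent ⟩
      N ^ ((6 + k) * A.wordExponent)       ≤⟨ ^-monoʳ-≤ N (*-monoʳ-≤ (6 + k) (n≤1+n A.wordExponent)) ⟩
      N ^ wordExponent                     ∎
      where open ≤-Reasoning

theorem4p21 : (k : ℕ) (T : ℕ → ℕ) → T =Ω (λ r → r) →
    (∃[ A ] (A Solves SubsetSum InTime T)) →
    ∃[ B ] (B Solves (k -SUM) InTime T)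
theorem4p21 k T T=Ω (A , solves) = B , record
  { time         = time
  ; time=O[T]    = time=O
  ; wordExponent = wordExponent
  ; run          = λ {r} X U X≤U → runFrom X X≤U (V≤W r U) (W-A≤W r U)
  }
  where open Composite k T T=Ω A solves
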